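{- For every Ferrers board $F$, the maps $\alpha: S_F(231)\to S_F(312)$ and $\beta: S_F(312)\to S_F(231)$ (defined by $S(\alpha(P),F)=S(P,F)^+$ for $P\in S_F(231)$ and $S(\beta(P),F)=S(P,F)^+$ for $P\in S_F(312)$) are inverses of each other, and therefore both are bijections.
   Context: Let $\mathcal{A}$ be an $m\times m$ array of unit squares in the $xy$-plane with its bottom left corner at the origin. The corners of squares are called vertices. For a vertex $V=(a,b)$, $R(V)$ denotes the rectangular array of squares bounded by the lines $x=0$, $x=a$, $y=0$, $y=b$ (empty if $a=0$ or $b=0$). A Ferrers board is a subset $F$ of $\mathcal{A}$ (for some $m$) such that $R(V)\subseteq F$ for each vertex $V$ of $F$ (a vertex of $F$ is a corner of a square of $F$). So $F$ is left- and bottom-justified. The right/up border of $F$ is the border of $F$ excluding the vertical left-hand side and the horizontal bottom side: it is the lattice path of unit rightward and downward steps along the boundary of $F$ from the top left corner $(0,h)$ of $F$ to the bottom right corner $(w,0)$, where $h$ is the length of the longest column and $w$ that of the longest row; both endpoints are vertices of the right/up border. A rook placement on $F$ is a subset of the squares of $F$ (the squares containing "markers") with at most one square in each row and at most one in each column of $F$; a full rook placement has exactly one marker in each row and each column of $F$. A rook placement $P$ on $F$ avoids a pattern $\tau$ if for every vertex $V$ on the right/up border of $F$ the permutation order-isomorphic to the restriction of $P$ to $R(V)$ (markers read left to right, by height) avoids $\tau$ in the usual sense (has no subsequence order-isomorphic to $\tau$). $S_F(\tau)$ is the set of all full rook placements on $F$ that avoid $\tau$. For a rook placement $P$ on $F$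 and a vertex $V$ of $F$, $S(P,V)$ is the maximal length of an increasing sequence of markers of $P$ in $R(V)$ (each successive marker strictly to the right of and strictly above the previous one); it is $0$ if $R(V)$ contains no marker. For a full rook placement $P$, $S(P,F)$ denotes the sequence of values $S(P,V)$ for all vertices $V$ on the right/up border of $F$, in order, starting with the top left corner of $F$. For a vertex $V$ on the right/up border of $F$, the number of markers of $P$ in $R(V)$ is the same for all full rook placements $P$ on $F$; this number is denoted $N(F,V)$. If $P$ is a full rook placement on $F$ and $S=S(P,F)$, then $S^+$ is the sequence of nonnegative integers indexed by the vertices $V$ on the right/up border of $F$ given by $S^+(V)=0$ if $S(V)=0$, and $S^+(V)=N(F,V)+1-S(V)$ otherwise. For $P\in S_F(231)$, $\alpha(P)$ denotes the unique element of $S_F(312)$ such that $S(\alpha(P),F)=S(P,F)^+$. For $P\in S_F(312)$, $\beta(P)$ denotes the unique element of $S_F(231)$ such that $S(\beta(P),F)=S(P,F)^+$. (The existence and uniqueness of these elements are established in the paper, so $\alpha$ and $\beta$ are well defined.) -}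

module Defs where

open import Data.Bool.Base using (Bool; T; if_then_else_)
open import Data.List.Base
  using (List; []; _∷_; _++_; map; filter; filterᵇ; upTo; cartesianProduct; zipWith; length)
open import Data.List.Extrema.Nat using (max)
open import Data.List.Membership.Propositional using () renaming (_∈_ to _∈ˡ_)
open import Data.List.Relation.Binary.Sublist.Propositional using (_⊆_)
open import Data.List.Relation.Unary.All using (All)
open import Data.List.Relation.Unary.Linked using (Linked; linked?)
open import Data.Nat.Base using (ℕ; zero; suc; _∸_; _<_)
open import Data.Nat.Properties using (_<?_)
open import Data.Product.Base using (_×_; _,_; ∃-syntax; proj₁; proj₂)
open import Data.Vec.Base as Vec using (Vec; []; _∷_)
open import Function.Base using (_on_)
open import Function.Bundles using (_⇔_)
open import Relation.Binary.Core using (Rel)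
open import Relation.Binary.Definitions using (Decidable)
open import Relation.Binary.PropositionalEquality.Core using (_≡_; _≗_)
open import Relation.Nullary.Decidable using (_×-dec_)
open import Relation.Nullary.Negation using (¬_)
open import Level using (0ℓ)

-- The square (i , j) is [i , i+1] × [j , j+1]: column i, row j, both from 0.

Square : Set
Square = ℕ × ℕ

Vertex : Set
Vertex = ℕ × ℕ

SquareSet : Set
SquareSet = Square → Bool

infix 4 _∈_

_∈_ : Square → SquareSet → Set
s ∈ A = T (A s)

corners : Square → List Vertex
corners (i , j) = (i , j) ∷ (suc i , j) ∷ (i , suc j) ∷ (suc i , suc j) ∷ []

-- Lexicographic order, so that filtering this list reads from left to right.

R : Vertex → List Square
R (a , b) = cartesianProduct (upTo a) (upTo b)

record FerrersBoard : Set where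
  field
    m       : ℕ
    squares : SquareSet
    bounded : ∀ i j → (i , j) ∈ squares → i < m × j < m

  IsVertex : Vertex → Set
  IsVertex V = ∃[ s ] s ∈ squares × V ∈ˡ corners s

  field
    closed  : ∀ V → IsVertex V → All (_∈ squares) (R V)

  columnLength : ℕ → ℕ
  columnLength i = length (filterᵇ (λ j → squares (i , j)) (upTo m))

  height : ℕ
  height = max 0 (map columnLength (upTo m))

  -- The part of the right/up border from (a , b) on, where r is the number of
  -- columns of the array to the right of x = a: step right if the square
  -- below that step is in the board, and down otherwise.

  borderFrom : (r a b : ℕ) → List Vertex
  borderFrom r       a zero    = (a , zero) ∷ []
  borderFrom zero    a (suc b) = (a , suc b) ∷ borderFrom zero a b
  borderFrom (suc r) a (suc b) = (a , suc b) ∷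
    (if squares (a , b) then borderFrom r (suc a) (suc b)
                        else borderFrom (suc r) a b)

  border : List Vertex
  border = borderFrom m 0 height

record RookPlacement (F : FerrersBoard) : Set where
  open FerrersBoard F
  field
    markers    : SquareSet
    onBoard    : ∀ s → s ∈ markers → s ∈ squares
    columnwise : ∀ i j j′ → (i , j) ∈ markers → (i , j′) ∈ markers → j ≡ j′
    rowwise    : ∀ i i′ j → (i , j) ∈ markers → (i′ , j) ∈ markers → i ≡ i′

  markersIn : Vertex → List Square
  markersIn V = filterᵇ markers (R V)

  IsFull : Set
  IsFull = (∀ i → (∃[ j ] (i , j) ∈ squares) → ∃[ j ] (i , j) ∈ markers)
         × (∀ j → (∃[ i ] (i , j) ∈ squares) → ∃[ i ] (i , j) ∈ markers)

Pattern : ℕ → Set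
Pattern k = Vec ℕ k

p231 : Pattern 3
p231 = 2 ∷ 3 ∷ 1 ∷ []

p312 : Pattern 3
p312 = 3 ∷ 1 ∷ 2 ∷ []

OrderIsomorphic : ∀ {k} → Rel (Vec ℕ k) 0ℓ
OrderIsomorphic u v =
  ∀ p q → (Vec.lookup u p < Vec.lookup u q) ⇔ (Vec.lookup v p < Vec.lookup v q)

Contains : ∀ {k} → List ℕ → Pattern k → Set
Contains w τ = ∃[ u ] Vec.toList u ⊆ w × OrderIsomorphic u τ

module _ {F : FerrersBoard} where
  open FerrersBoard F
  open RookPlacement

  Avoids : ∀ {k} → RookPlacement F → Pattern k → Set
  Avoids P τ = ∀ V → V ∈ˡ border → ¬ Contains (map proj₂ (markersIn P V)) τ

record FullAvoiding {k} (F : FerrersBoard) (τ : Pattern k) : Set where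
  field
    placement : RookPlacement F
    full      : RookPlacement.IsFull placement
    avoids    : Avoids placement τ

  open RookPlacement placement public

infix 4 _≈_

_≈_ : ∀ {F k} {τ : Pattern k} → Rel (FullAvoiding F τ) 0ℓ
_≈_ = _≗_ on FullAvoiding.markers

_↗_ : Rel Square 0ℓ
(i , j) ↗ (i′ , j′) = i < i′ × j < j′

_↗?_ : Decidable _↗_
(i , j) ↗? (i′ , j′) = (i <? i′) ×-dec (j <? j′)

subsequences : ∀ {A : Set} → List A → List (List A)
subsequences []       = [] ∷ []
subsequences (x ∷ xs) = map (x ∷_) (subsequences xs) ++ subsequences xs

longestIncreasing : List Square → ℕ
longestIncreasing ss = max 0 (map length (filter (linked? _↗?_) (subsequences ss)))

reflect : (n s : ℕ) → ℕ
reflect n zero      = 0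
reflect n s@(suc _) = suc n ∸ s

module _ {F : FerrersBoard} (P : RookPlacement F) where
  open FerrersBoard F
  open RookPlacement P

  S : Vertex → ℕ
  S V = longestIncreasing (markersIn V)

  -- For V on the border and P full, this depends only on F and V.

  N : Vertex → ℕ
  N V = length (markersIn V)

  S-sequence : List ℕ
  S-sequence = map S border

  S⁺-sequence : List ℕ
  S⁺-sequence = zipWith reflect (map N border) S-sequence

-- The defining equation of α (for σ = 231, τ = 312) and β (σ and τ exchanged)

Reflects : ∀ {F k l} {σ : Pattern k} {τ : Pattern l} →
           (FullAvoiding F σ → FullAvoiding F τ) → Set
Reflects f = ∀ P → S-sequence (placement (f P)) ≡ S⁺-sequence (placement P)
  where open FullAvoiding

{-# OPTIONS --safe #-}

-- Reflection n ↦ N + 1 − n is an involution on positive values and N does not depend on the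
-- full placement, so the theorem reduces to: a 231-avoiding (or 312-avoiding) full placement P
-- is determined by S(P, F). The case of 312 is that of 231 on the transposed board.
--
-- For 231, the placement is reconstructed column by column from the right, together with the
-- values S(a, k) along the line x = a. Let column a hold its marker in row j. The markers
-- above row j and to its left decrease, so S(a + 1, k) = S(a + 1, j) + 1 for every k > j in the
-- board: j is the last jump of S along x = a + 1. On x = a, S is unchanged up to height j; up
-- to the height of the column it takes at most one more value S(a, j) + 1, which is attained iff
-- it is attained at the border vertex, and then it is attained right above the lowest marker over
-- row j to the left of column a, as this marker is also the rightmost one.

module Submission where

open import Algebra.Properties.CommutativeSemigroup using (interchange)
open import Data.Bool.Base using (Bool; true; false; T; if_then_else_)
open import Data.Bool.Properties using (T?)
open import Data.Fin.Base using (zero; suc)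
open import Data.List.Base
  using (List; []; _∷_; _++_; _∷ʳ_; map; length; upTo; applyUpTo; filter; filterᵇ; cartesianProduct; zipWith)
open import Data.List.Extrema.Nat using (argmax-sel; xs≤max)
open import Data.List.Membership.Propositional using () renaming (_∈_ to _∈ˡ_)
open import Data.List.Membership.Propositional.Properties
  using (∈-map⁺; ∈-map⁻; ∈-++⁺ˡ; ∈-++⁺ʳ; ∈-++⁻; ∈-filter⁺; ∈-filter⁻; ∈-upTo⁺; ∈-upTo⁻;
         ∈-cartesianProduct⁺; ∈-cartesianProduct⁻)
open import Data.List.Properties
  using (upTo-∷ʳ; filter-all; filter-++; filter-≐; length-++; map-++; ++-identityʳ;
         cartesianProductWith-distribʳ-++; ∷-injectiveˡ; ∷-injectiveʳ)
open import Data.List.Relation.Binary.Sublist.Propositional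
  using (_⊆_; []; _∷_; ⊆-refl; ⊆-trans; from∈; minimum; lookup) renaming (_∷ʳ_ to skip)
open import Data.List.Relation.Binary.Sublist.Propositional.Properties
  using (length-mono-≤; ++⁺; ++⁺ˡ; filter⁺) renaming (map⁺ to ⊆-map⁺)
open import Data.List.Relation.Unary.All as All using (All; []; _∷_)
import Data.List.Relation.Unary.All.Properties as All
open import Data.List.Relation.Unary.AllPairs using (AllPairs; []; _∷_)
import Data.List.Relation.Unary.AllPairs.Properties as AllPairs
open import Data.List.Relation.Unary.Any using (here; there)
open import Data.List.Relation.Unary.Linked using (Linked; [-]; _∷_; linked?)
open import Data.List.Relation.Unary.Linked.Properties using (AllPairs⇒Linked)
open import Data.Nat.Base
open import Data.Nat.Properties
open import Data.Product.Base using (_×_; _,_; ∃-syntax; proj₁; proj₂; swap)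
open import Data.Product.Properties using (≡-dec)
open import Data.Sum.Base using (inj₁; inj₂)
open import Data.Vec.Base using ([]; _∷_)
open import Defs
open import Function.Base using (_∘_; flip; id)
open import Function.Bundles using (_⇔_; mk⇔)
open import Function.Consequences using (inverseᵇ⇒bijective)
open import Function.Definitions using (Inverseᵇ; Bijective)
open import Level using (0ℓ)
open import Relation.Binary.Core using (Rel)
open import Relation.Binary.Definitions using (Decidable; tri<; tri≈; tri>)
open import Relation.Binary.PropositionalEquality
  using (_≡_; _≢_; refl; sym; trans; cong; cong₂; subst; subst₂; module ≡-Reasoning)
open import Relation.Nullary using (¬_; yes; no; contradiction; from-yes; from-no)
import Relation.Unary as U

-- Chains, boards and full placements as relations on the naturals.

-- Chain P a b t: P has an increasing sequence of t points in [0 , a) × [0 , b).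

data Chain (P : Rel ℕ 0ℓ) : ℕ → ℕ → ℕ → Set where
  []   : ∀ {a b} → Chain P a b 0
  snoc : ∀ {a b i j t} → i < a → j < b → P i j → Chain P i j t → Chain P a b (suc t)

module _ {P : Rel ℕ 0ℓ} where

  weaken : ∀ {a a′ b b′ t} → a ≤ a′ → b ≤ b′ → Chain P a b t → Chain P a′ b′ t
  weaken a≤a′ b≤b′ []               = []
  weaken a≤a′ b≤b′ (snoc i<a j<b p c) = snoc (<-≤-trans i<a a≤a′) (<-≤-trans j<b b≤b′) p c

  chain-flip : ∀ {a b t} → Chain P a b t → Chain (flip P) b a t
  chain-flip []                 = []
  chain-flip (snoc i<a j<b p c) = snoc j<b i<a p (chain-flip c)

  chain-length≤ : ∀ {a b t} → Chain P a b t → t ≤ b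
  chain-length≤ []                 = z≤n
  chain-length≤ (snoc i<a j<b p c) = ≤-<-trans (chain-length≤ c) j<b

record IsBoard (F : Rel ℕ 0ℓ) : Set where
  field
    dec     : Decidable F
    size    : ℕ
    bounded : ∀ {i j} → F i j → i < size × j < size
    closed  : ∀ {i i′ j j′} → i′ ≤ i → j′ ≤ j → F i j → F i′ j′

record IsFull (F P : Rel ℕ 0ℓ) : Set where
  field
    onBoard    : ∀ {i j} → P i j → F i j
    columnwise : ∀ {i j j′} → P i j → P i j′ → j ≡ j′
    rowwise    : ∀ {i i′ j} → P i j → P i′ j → i ≡ i′
    inColumn   : ∀ {i j} → F i j → ∃[ j′ ] P i j′
    inRow      : ∀ {i j} → F i j → ∃[ i′ ] P i′ j

-- Some rectangle at a border vertex holds all three markers exactly when the square in the column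
-- of the rightmost and the row of the highest marker is on the board; hence `F i₃ j₂` and
-- `F i₃ j₁`.
Avoids231 Avoids312 : (F P : Rel ℕ 0ℓ) → Set
Avoids231 F P = ∀ {i₁ i₂ i₃ j₁ j₂ j₃} → i₁ < i₂ → i₂ < i₃ → j₃ < j₁ → j₁ < j₂ → F i₃ j₂ →
                P i₁ j₁ → P i₂ j₂ → ¬ P i₃ j₃
Avoids312 F P = ∀ {i₁ i₂ i₃ j₁ j₂ j₃} → i₁ < i₂ → i₂ < i₃ → j₂ < j₃ → j₃ < j₁ → F i₃ j₁ →
                P i₁ j₁ → P i₂ j₂ → ¬ P i₃ j₃

-- Equality of the maximal lengths without naming them: a chain can be shortened, so the lengths `t`
-- that occur form an initial segment.
SameChains : (P Q : Rel ℕ 0ℓ) → ℕ → ℕ → Set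
SameChains P Q a b = ∀ t → (Chain P a b t → Chain Q a b t) × (Chain Q a b t → Chain P a b t)

-- The two conditions single out the border vertices off the axes; on the axes every chain is empty.
SameBorderChains : (F P Q : Rel ℕ 0ℓ) → Set
SameBorderChains F P Q =
  ∀ {i j} → F i j → ¬ F (suc i) (suc j) → SameChains P Q (suc i) (suc j)

lastTrue : ∀ {p : ℕ → Set} → U.Decidable p → p 0 → ∀ n → ¬ p n → ∃[ k ] p k × ¬ p (suc k)
lastTrue p? p0 zero    ¬p0 = contradiction p0 ¬p0
lastTrue p? p0 (suc n) ¬pn with p? n
... | yes pn = n , pn , ¬pn
... | no ¬pn = lastTrue p? p0 n ¬pn

-- One column of a 231-avoiding placement.

module _ {F P : Rel ℕ 0ℓ} (full : IsFull F P) (avoids : Avoids231 F P)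
         {a j : ℕ} (marker : P a j) where
  open IsFull full

  -- The only marker of column `a` is in row `j`, too high for these chains.
  drop-column : ∀ {k t} → k ≤ j → Chain P (suc a) k t → Chain P a k t
  drop-column k≤j []                              = []
  drop-column k≤j (snoc (s≤s i≤a) y<k p c) with m≤n⇒m<n∨m≡n i≤a
  ... | inj₁ i<a  = snoc i<a y<k p c
  ... | inj₂ refl = contradiction (columnwise p marker) (<⇒≢ (<-≤-trans y<k k≤j))

  raise : ∀ {k t} → j < k → Chain P (suc a) j t → Chain P (suc a) k (suc t)
  raise j<k c = snoc ≤-refl j<k marker (drop-column ≤-refl c)

  -- To the left of a, the markers above row j decrease, so at most one of them is in a chain.
  below : ∀ {i y t} → P i y → i < a → j < y → F a y → Chain P i y t → Chain P i j t
  below p i<a j<y Fay []                       = []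
  below p i<a j<y Fay (snoc {j = y′} i′<i y′<y p′ c) with <-cmp y′ j
  ... | tri< y′<j _ _ = snoc i′<i y′<j p′ c
  ... | tri≈ _ refl _ = contradiction (rowwise p′ marker) (<⇒≢ (<-trans i′<i i<a))
  ... | tri> _ _ j<y′ = contradiction marker (avoids i′<i i<a j<y′ y′<y Fay p′ p)

  -- Removing the top marker is enough: the rest lies below row `j`, either because the top is not
  -- above that row or by `below`.
  lower : ∀ {k t} → (∀ {y} → y < k → F a y) → Chain P (suc a) k (suc t) → Chain P (suc a) j t
  lower Fa (snoc {j = y} i≤a@(s≤s i≤a′) y<k p c) with y ≤? j
  ... | yes y≤j = weaken (<⇒≤ i≤a) y≤j c
  ... | no  y≰j with m≤n⇒m<n∨m≡n i≤a′
  ...   | inj₁ i<a  = weaken (<⇒≤ i≤a) ≤-refl (below p i<a (≰⇒> y≰j) (Fa y<k) c)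
  ...   | inj₂ refl = contradiction (≤-reflexive (columnwise p marker)) y≰j

-- Comparison of two placements, column by column from the right.

Agree : ℕ → (P Q : Rel ℕ 0ℓ) → Set
Agree a P Q = ∀ {i j} → a ≤ i → (P i j → Q i j) × (Q i j → P i j)

-- The equation `a ≡ suc i` makes this void at `a = 0`, so that the induction can run down to the
-- left edge.
SameChainsAt : ℕ → (F P Q : Rel ℕ 0ℓ) → Set
SameChainsAt a F P Q = ∀ {i k} → a ≡ suc i → F i k → SameChains P Q a (suc k)

module _ {F P Q : Rel ℕ 0ℓ} (board : IsBoard F)
         (fullP : IsFull F P) (fullQ : IsFull F Q)
         (avP : Avoids231 F P) (avQ : Avoids231 F Q) where
  open IsBoard board
  private
    module P = IsFull fullP
    module Q = IsFull fullQ

  -- Raising a chain of Q over row j′ and lowering it in P below row j < j′ would give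
  -- chains of unbounded length.
  marker≮ : ∀ {a j j′} → SameChainsAt (suc a) F P Q → P a j → Q a j′ → ¬ j < j′
  marker≮ {a} {j} {suc j″} same p q j<j′ = contradiction (chain-length≤ (long (suc (suc j″)))) 1+n≰n
    where
    long : ∀ t → Chain Q (suc a) (suc j″) t
    long zero    = []
    long (suc t) =
      proj₁ (same refl (closed ≤-refl (n≤1+n j″) (Q.onBoard q)) (suc t))
        (raise fullP avP p j<j′
          (lower fullP avP p (λ y≤j′ → closed ≤-refl (≤-pred y≤j′) (Q.onBoard q))
            (proj₂ (same refl (Q.onBoard q) (suc t))
              (raise fullQ avQ q ≤-refl (long t)))))

  -- If the marker of `Q` in row `y` were in column `a` or beyond, it would be a marker of `P` too,
  -- and a second one in that row.
  row-marker : ∀ {a x y} → Agree a P Q → P x y → x < a → ∃[ x′ ] x′ < a × Q x′ y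
  row-marker {a} agree p x<a with Q.inRow (P.onBoard p)
  ... | x′ , q with x′ <? a
  ...   | yes x′<a = x′ , x′<a , q
  ...   | no  x′≮a with P.rowwise p (proj₂ (agree (≮⇒≥ x′≮a)) q)
  ...     | refl = contradiction x<a x′≮a

  -- Below row `j` the comparison on the line to the right decides. A chain with its top above row
  -- `j` is transferred at a border vertex on the line x = `a`, and `high` brings the result back
  -- down to height `suc k`.
  chain⇒ : SameBorderChains F P Q → ∀ {a j} → P a j → Q a j → Agree a P Q →
           SameChainsAt (suc a) F P Q →
           ∀ {i k t} → a ≡ suc i → F i k → Chain P a (suc k) t → Chain Q a (suc k) t
  chain⇒ border {a} {j} pj qj agree same a≡ Fik = at a≡ Fik
    where
    -- Up to height `j` the lines x = `a` and x = `suc a` see the same chains.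
    low : ∀ {k t} → k ≤ j → Chain P a k t → Chain Q a k t
    low {zero}  k≤j []                 = []
    low {suc k} k≤j c = drop-column fullQ avQ qj k≤j
      (proj₁ (same refl (closed ≤-refl (<⇒≤ k≤j) (P.onBoard pj)) _) (weaken (n≤1+n a) ≤-refl c))

    -- The row of the top of the chain of P carries a marker of Q, and it lies to the right of
    -- the top of the given chain of Q as soon as it lies below it.
    high : ∀ {x y k b t} → P x y → x < a → j < y → y < k → (∀ {z} → z < b → F a z) →
           Chain Q a b (suc t) → Chain Q a k (suc t)
    high {x} {y} {k} p x<a j<y y<k Fa (snoc {i = x₂} {j = y₂} x₂<a y₂<b q c) with y₂ ≤? y
    ... | yes y₂≤y = snoc x₂<a (≤-<-trans y₂≤y y<k) q c
    ... | no  y₂≰y with row-marker agree p x<a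
    ...   | x′ , x′<a , q′ with <-cmp x′ x₂
    ...     | tri< x′<x₂ _ _ = contradiction qj (avQ x′<x₂ x₂<a j<y (≰⇒> y₂≰y) (Fa y₂<b) q′ q)
    ...     | tri≈ _ refl _  = contradiction (≤-reflexive (Q.columnwise q q′)) y₂≰y
    ...     | tri> _ _ x₂<x′ =
      snoc x′<a y<k q′
        (weaken (<⇒≤ x₂<x′) (<⇒≤ j<y)
          (below fullQ avQ qj q x₂<a (<-trans j<y (≰⇒> y₂≰y)) (Fa y₂<b) c))

    at : ∀ {i k t} → a ≡ suc i → F i k → Chain P a (suc k) t → Chain Q a (suc k) t
    at {i} {k} refl Fik []                                      = []
    at {i} {k} refl Fik c@(snoc {j = y} x<a y≤k p c′) with <-cmp y j
    ... | tri< y<j _ _ = weaken ≤-refl y≤k (low y<j (snoc x<a ≤-refl p c′))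
    ... | tri≈ _ refl _ = contradiction (P.rowwise p pj) (<⇒≢ x<a)
    ... | tri> _ _ j<y with dec a (suc k)
    ...   | no ¬Fak = proj₁ (border Fik ¬Fak _) c
    -- The search climbs column `a` to a square with none above it; the upper left corner of that
    -- square is a border vertex.
    ...   | yes Fak with lastTrue (λ d → dec a (suc k + d)) (subst (F a) (sym (+-identityʳ (suc k))) Fak) size
                     (λ Fs → ≤⇒≯ (m≤n+m size (suc k)) (proj₂ (bounded Fs)))
    ...     | d , Fd , ¬Fsd =
      high p x<a j<y y≤k (λ z<b → closed ≤-refl (≤-pred z<b) Fd)
        (proj₁ (border (closed (n≤1+n i) ≤-refl Fd) (subst (¬_ ∘ F a) (+-suc (suc k) d) ¬Fsd) _)
          (weaken ≤-refl (s≤s (≤-trans (n≤1+n k) (m≤m+n (suc k) d))) c))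

module _ {F P Q : Rel ℕ 0ℓ} (board : IsBoard F)
         (fullP : IsFull F P) (fullQ : IsFull F Q)
         (avP : Avoids231 F P) (avQ : Avoids231 F Q)
         (border : SameBorderChains F P Q) where
  open IsBoard board
  private
    module P = IsFull fullP
    module Q = IsFull fullQ

  private
    border′ : SameBorderChains F Q P
    border′ f ¬f t = swap (border f ¬f t)

  -- When column `a` is empty, each vertex `(a , suc k)` of the board is on the border.
  off-board : ∀ {a} → ¬ F a 0 → SameChainsAt a F P Q
  off-board ¬Fa refl f = border f (¬Fa ∘ closed ≤-refl z≤n)

  extend-agreement : ∀ {a} → Agree (suc a) P Q → (∀ {j} → (P a j → Q a j) × (Q a j → P a j)) →
                     Agree a P Q
  extend-agreement agree column a≤i with m≤n⇒m<n∨m≡n a≤i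
  ... | inj₁ a<i  = agree a<i
  ... | inj₂ refl = column

  -- In a nonempty column, `marker≮` in both directions puts the two markers in the same row; then
  -- `chain⇒` in both directions moves the comparison to x = `a`.
  previous-column : ∀ {a} → Agree (suc a) P Q → SameChainsAt (suc a) F P Q →
                    Agree a P Q × SameChainsAt a F P Q
  previous-column {a} agree same with dec a 0
  ... | no ¬Fa0 = extend-agreement agree
                    ( (λ p → contradiction (closed ≤-refl z≤n (P.onBoard p)) ¬Fa0)
                    , (λ q → contradiction (closed ≤-refl z≤n (Q.onBoard q)) ¬Fa0))
                , off-board ¬Fa0
  ... | yes Fa0 with P.inColumn Fa0 | Q.inColumn Fa0
  ...   | j , p | j′ , q with ≤-antisym (≮⇒≥ (marker≮ board fullQ fullP avQ avP same′ q p))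
                                         (≮⇒≥ (marker≮ board fullP fullQ avP avQ same p q))
    where
    same′ : SameChainsAt (suc a) F Q P
    same′ e f t = swap (same e f t)
  ...     | refl = agree-a , λ e f t →
      chain⇒ board fullP fullQ avP avQ border p q agree-a same e f
    , chain⇒ board fullQ fullP avQ avP border′ q p (λ a≤i → swap (agree-a a≤i))
        (λ e f t → swap (same e f t)) e f
    where
    agree-a : Agree a P Q
    agree-a = extend-agreement agree
      ( (λ p′ → subst (Q a) (P.columnwise p p′) q)
      , (λ q′ → subst (P a) (Q.columnwise q q′) p))

  -- Downward induction on `a`: `d` bounds the number of columns from `a` on, and at `d = 0` the
  -- line x = `a` is at or beyond the right edge of the array.
  agree-from : ∀ d {a} → size ≤ a + d → Agree a P Q × SameChainsAt a F P Q
  agree-from zero {a} size≤a =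
      (λ a≤i → (λ p → contradiction (proj₁ (bounded (P.onBoard p))) (outside a≤i))
             , (λ q → contradiction (proj₁ (bounded (Q.onBoard q))) (outside a≤i)))
    , off-board (λ f → outside ≤-refl (proj₁ (bounded f)))
    where
    outside : ∀ {i} → a ≤ i → ¬ i < size
    outside a≤i = ≤⇒≯ (≤-trans size≤a (≤-trans (≤-reflexive (+-identityʳ a)) a≤i))
  agree-from (suc d) {a} size≤ with agree-from d {suc a} (subst (size ≤_) (+-suc a d) size≤)
  ... | agree , same = previous-column agree same

  unique231 : ∀ i j → (P i j → Q i j) × (Q i j → P i j)
  unique231 i j = proj₁ (agree-from size ≤-refl) z≤n

-- Transposition replaces 312 by its inverse 231 and keeps increasing sequences increasing.
unique312 : ∀ {F P Q : Rel ℕ 0ℓ} → IsBoard F → IsFull F P → IsFull F Q →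
            Avoids312 F P → Avoids312 F Q → SameBorderChains F P Q →
            ∀ i j → (P i j → Q i j) × (Q i j → P i j)
unique312 {F} board fullP fullQ avP avQ border i j =
  unique231 transposed-board (transpose-full fullP) (transpose-full fullQ)
    (transpose-avoids avP) (transpose-avoids avQ)
    (λ f ¬f t → chain-flip ∘ proj₁ (border f ¬f t) ∘ chain-flip
              , chain-flip ∘ proj₂ (border f ¬f t) ∘ chain-flip) j i
  where
  transposed-board : IsBoard (flip F)
  transposed-board = let open IsBoard board in record
    { dec = flip dec ; size = size ; bounded = swap ∘ bounded ; closed = flip closed }

  transpose-full : ∀ {P} → IsFull F P → IsFull (flip F) (flip P)
  transpose-full full = let open IsFull full in record
    { onBoard = onBoard ; columnwise = rowwise ; rowwise = columnwise
    ; inColumn = inRow ; inRow = inColumn }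

  transpose-avoids : ∀ {P} → Avoids312 F P → Avoids231 (flip F) (flip P)
  transpose-avoids av i₁<i₂ i₂<i₃ j₃<j₁ j₁<j₂ f p₁ p₂ p₃ =
    av j₃<j₁ j₁<j₂ i₁<i₂ i₂<i₃ f p₃ p₁ p₂

-- Chains and increasing sublists of the list of markers.

module _ {A : Set} where

  subsequence⁺ : {xs ys : List A} → xs ⊆ ys → xs ∈ˡ subsequences ys
  subsequence⁺ []             = here refl
  subsequence⁺ (skip y xs⊆)   = ∈-++⁺ʳ (map (y ∷_) _) (subsequence⁺ xs⊆)
  subsequence⁺ (refl ∷ xs⊆)   = ∈-++⁺ˡ (∈-map⁺ _ (subsequence⁺ xs⊆))

  subsequence⁻ : {xs : List A} (ys : List A) → xs ∈ˡ subsequences ys → xs ⊆ ys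
  subsequence⁻ []       (here refl) = []
  subsequence⁻ (y ∷ ys) xs∈ with ∈-++⁻ (map (y ∷_) (subsequences ys)) xs∈
  ... | inj₂ xs∈ys = skip y (subsequence⁻ ys xs∈ys)
  ... | inj₁ xs∈y∷ with ∈-map⁻ (y ∷_) xs∈y∷
  ...   | _ , zs∈ys , refl = refl ∷ subsequence⁻ ys zs∈ys

∷ʳ-⊆-upTo : ∀ {is i a} → is ⊆ upTo i → i < a → is ∷ʳ i ⊆ upTo a
∷ʳ-⊆-upTo {is} {i} is⊆ i<a =
  ⊆-trans (subst (is ∷ʳ i ⊆_) (upTo-∷ʳ i) (++⁺ is⊆ ⊆-refl)) (upTo-mono i<a)
  where
  upTo-mono : ∀ {m n} → m ≤ n → upTo m ⊆ upTo n
  upTo-mono {m} m≤n with ≤⇒≤′ m≤n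
  ... | ≤′-reflexive refl = ⊆-refl
  ... | ≤′-step {n} m≤′n = ⊆-trans (upTo-mono (≤′⇒≤ m≤′n))
        (subst (upTo n ⊆_) (upTo-∷ʳ n) (subst (_⊆ upTo n ∷ʳ n) (++-identityʳ (upTo n)) (++⁺ ⊆-refl (minimum _))))

-- The first coordinates take at most one pair from each block of the product, so for the second
-- coordinates membership is enough.
⊆-cartesianProduct : ∀ {A B : Set} {l : List (A × B)} {xs : List A} {ys : List B} →
                     map proj₁ l ⊆ xs → All ((_∈ˡ ys) ∘ proj₂) l → l ⊆ cartesianProduct xs ys
⊆-cartesianProduct {l = []}    _ _ = minimum _
⊆-cartesianProduct {l = _ ∷ _} {ys = ys} (skip x l⊆) y∈ = ++⁺ˡ (map (x ,_) ys) (⊆-cartesianProduct l⊆ y∈)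
⊆-cartesianProduct {l = _ ∷ _} (refl ∷ l⊆) (y∈ ∷ ys∈) =
  ++⁺ (from∈ (∈-map⁺ _ y∈)) (⊆-cartesianProduct l⊆ ys∈)

Marks : SquareSet → Rel ℕ 0ℓ
Marks A i j = (i , j) ∈ A

module _ (A : SquareSet) where

  ⊆-markers : ∀ {a b} {l : List Square} → map proj₁ l ⊆ upTo a → All (λ s → proj₂ s < b) l →
              All (_∈ A) l → l ⊆ filterᵇ A (R (a , b))
  ⊆-markers l⊆ l<b l∈A =
    subst (_⊆ _) (filter-all (T? ∘ A) l∈A)
      (filter⁺ _ _ (λ { refl → id }) (⊆-cartesianProduct l⊆ (All.map ∈-upTo⁺ l<b)))

  ∈-markers⁻ : ∀ {a b i j} → (i , j) ∈ˡ filterᵇ A (R (a , b)) → (i < a × j < b) × (i , j) ∈ A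
  ∈-markers⁻ {a} {b} s∈ with ∈-filter⁻ (T? ∘ A) {xs = R (a , b)} s∈
  ... | s∈R , s∈A with ∈-cartesianProduct⁻ (upTo a) (upTo b) s∈R
  ...   | i∈ , j∈ = (∈-upTo⁻ i∈ , ∈-upTo⁻ j∈) , s∈A

  -- `AllPairs` is carried along because it extends easily at the right end; `Linked` is derived
  -- from it later.
  chain⇒list : ∀ {a b t} → Chain (Marks A) a b t →
               ∃[ l ] length l ≡ t × map proj₁ l ⊆ upTo a × AllPairs _↗_ l ×
                      All (_↗ (a , b)) l × All (_∈ A) l
  chain⇒list [] = [] , refl , minimum _ , [] , [] , []
  chain⇒list (snoc {i = i} {j = j} i<a j<b p c) with chain⇒list c
  ... | l , refl , l⊆ , pairs , l↗ , l∈A =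
      l ∷ʳ (i , j)
    , trans (length-++ l) (+-comm (length l) 1)
    , subst (_⊆ _) (sym (map-++ proj₁ l _)) (∷ʳ-⊆-upTo l⊆ i<a)
    , AllPairs.++⁺ pairs ([] ∷ []) (All.map (_∷ []) l↗)
    , All.++⁺ (All.map (λ (x<i , y<j) → <-trans x<i i<a , <-trans y<j j<b) l↗) ((i<a , j<b) ∷ [])
    , All.++⁺ l∈A (p ∷ [])

  -- A list is read from its lowest marker while a chain grows at its top, so `c` accumulates the
  -- markers already read and `(i , j)` comes next.
  list⇒chain : ∀ {a b i j t} {l : List Square} → Chain (Marks A) i j t → Linked _↗_ ((i , j) ∷ l) →
               All (λ s → s ↗ (a , b) × s ∈ A) ((i , j) ∷ l) →
               Chain (Marks A) a b (suc (t + length l))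
  list⇒chain {a} {b} {t = t} {l = []} c [-] (((i<a , j<b) , p) ∷ []) =
    subst (Chain (Marks A) a b ∘ suc) (sym (+-identityʳ t)) (snoc i<a j<b p c)
  list⇒chain {a} {b} {t = t} {l = _ ∷ l} c ((i<i′ , j<j′) ∷ linked) ((_ , p) ∷ ps) =
    subst (Chain (Marks A) a b ∘ suc) (sym (+-suc t (length l)))
      (list⇒chain (snoc i<i′ j<j′ p c) linked ps)

  module _ {a b : ℕ} where

    private
      ms  = filterᵇ A (R (a , b))
      inc = filter (linked? _↗?_) (subsequences ms)

    chain⇒≤longest : ∀ {t} → Chain (Marks A) a b t → t ≤ longestIncreasing ms
    chain⇒≤longest c with chain⇒list c
    ... | l , refl , l⊆ , pairs , l↗ , l∈A =
      All.lookup (xs≤max 0 (map length inc))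
        (∈-map⁺ length (∈-filter⁺ (linked? _↗?_)
          (subsequence⁺ (⊆-markers l⊆ (All.map proj₂ l↗) l∈A)) (AllPairs⇒Linked pairs)))

    longest-chain : Chain (Marks A) a b (longestIncreasing ms)
    longest-chain with argmax-sel id 0 (map length inc)
    -- The default value 0 of the maximum is realised by the empty chain.
    ... | inj₁ ≡0 = subst (Chain _ a b) (sym ≡0) []
    ... | inj₂ len∈ with ∈-map⁻ length len∈
    ...   | l , l∈inc , ≡len with ∈-filter⁻ (linked? _↗?_) l∈inc
    ...     | l∈subs , linked =
      subst (Chain _ a b) (sym ≡len) (build l linked (subsequence⁻ ms l∈subs))
      where
      build : ∀ l → Linked _↗_ l → l ⊆ ms → Chain (Marks A) a b (length l)
      build []      linked l⊆ = []
      build (_ ∷ _) linked l⊆ = list⇒chain [] linked (All.tabulate (∈-markers⁻ ∘ lookup l⊆))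

    -- This is S ≤ N, the condition for `reflect` to be undone by a second reflection.
    longest≤length : longestIncreasing ms ≤ length ms
    longest≤length with argmax-sel id 0 (map length inc)
    ... | inj₁ ≡0 = subst (_≤ length ms) (sym ≡0) z≤n
    ... | inj₂ len∈ with ∈-map⁻ length len∈
    ...   | l , l∈inc , ≡len =
      subst (_≤ length ms) (sym ≡len)
        (length-mono-≤ (subsequence⁻ ms (proj₁ (∈-filter⁻ (linked? _↗?_) l∈inc))))

shorten : ∀ {P a b s t} → t ≤ s → Chain P a b s → Chain P a b t
shorten z≤n       c                        = []
shorten (s≤s t≤s) (snoc i<a j<b p c) = snoc i<a j<b p (shorten t≤s c)

same-longest⇒same-chains : ∀ A B {a b} →
  longestIncreasing (filterᵇ A (R (a , b))) ≡ longestIncreasing (filterᵇ B (R (a , b))) →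
  SameChains (Marks A) (Marks B) a b
same-longest⇒same-chains A B eq t =
    (λ c → shorten (≤-trans (chain⇒≤longest A c) (≤-reflexive eq)) (longest-chain B))
  , (λ c → shorten (≤-trans (chain⇒≤longest B c) (≤-reflexive (sym eq))) (longest-chain A))

-- Counting markers by finite sums, and the reflection of values.

Σ<_ : ℕ → (ℕ → ℕ) → ℕ
(Σ< zero)  f = 0
(Σ< suc n) f = (Σ< n) f + f n

Σ-cong : ∀ n {f g : ℕ → ℕ} → (∀ {i} → i < n → f i ≡ g i) → (Σ< n) f ≡ (Σ< n) g
Σ-cong zero    f≡g = refl
Σ-cong (suc n) f≡g = cong₂ _+_ (Σ-cong n (f≡g ∘ m≤n⇒m≤1+n)) (f≡g ≤-refl)

Σ-+ : ∀ n (f g : ℕ → ℕ) → (Σ< n) (λ i → f i + g i) ≡ (Σ< n) f + (Σ< n) g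
Σ-+ zero    f g = refl
Σ-+ (suc n) f g rewrite Σ-+ n f g =
  interchange +-commutativeSemigroup ((Σ< n) f) ((Σ< n) g) (f n) (g n)

indicator : Bool → ℕ
indicator b = if b then 1 else 0

indicator-T : ∀ {b} → T b → indicator b ≡ 1
indicator-T {true} _ = refl

indicator-¬T : ∀ {b} → ¬ T b → indicator b ≡ 0
indicator-¬T {true}  ¬t = contradiction _ ¬t
indicator-¬T {false} ¬t = refl

Σ-none : ∀ n (p : ℕ → Bool) → (∀ {i} → i < n → ¬ T (p i)) → (Σ< n) (indicator ∘ p) ≡ 0
Σ-none zero    p none = refl
Σ-none (suc n) p none
  rewrite Σ-none n p (none ∘ m≤n⇒m≤1+n) = indicator-¬T (none ≤-refl)

Σ-unique : ∀ n (p : ℕ → Bool) {k} → k < n → T (p k) → (∀ {i} → T (p i) → i ≡ k) →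
           (Σ< n) (indicator ∘ p) ≡ 1
Σ-unique (suc n) p {k} (s≤s k≤n) pk unique with m≤n⇒m<n∨m≡n k≤n
... | inj₂ refl
  rewrite Σ-none n p (λ i<n pi → <⇒≢ i<n (unique pi)) = indicator-T pk
... | inj₁ k<n
  rewrite Σ-unique n p k<n pk unique | indicator-¬T (λ pn → <⇒≢ k<n (sym (unique pn))) = refl

module _ {A : Set} (p : A → Bool) where

  count : List A → ℕ
  count = length ∘ filterᵇ p

  count-++ : ∀ xs ys → count (xs ++ ys) ≡ count xs + count ys
  count-++ xs ys = trans (cong length (filter-++ (T? ∘ p) xs ys)) (length-++ (filterᵇ p xs))

  count-singleton : ∀ x → count (x ∷ []) ≡ indicator (p x)
  count-singleton x with p x
  ... | true  = refl
  ... | false = refl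

  count-upTo : ∀ (g : ℕ → A) n → count (map g (upTo n)) ≡ (Σ< n) (indicator ∘ p ∘ g)
  count-upTo g zero    = refl
  count-upTo g (suc n) = begin
    count (map g (upTo (suc n)))                        ≡⟨ cong (count ∘ map g) (upTo-∷ʳ n) ⟨
    count (map g (upTo n ∷ʳ n))                         ≡⟨ cong count (map-++ g (upTo n) _) ⟩
    count (map g (upTo n) ∷ʳ g n)                       ≡⟨ count-++ (map g (upTo n)) _ ⟩
    count (map g (upTo n)) + count (g n ∷ [])           ≡⟨ cong₂ _+_ (count-upTo g n) (count-singleton (g n)) ⟩
    (Σ< n) (indicator ∘ p ∘ g) + indicator (p (g n))    ∎
    where open ≡-Reasoning

module _ (A : SquareSet) where

  tally : ℕ → ℕ → ℕ
  tally a b = (Σ< a) λ i → (Σ< b) λ j → indicator (A (i , j))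

  row-tally : ℕ → ℕ → ℕ
  row-tally a j = (Σ< a) λ i → indicator (A (i , j))

  length-markers : ∀ a b → length (filterᵇ A (R (a , b))) ≡ tally a b
  length-markers zero    b = refl
  length-markers (suc a) b = begin
    count A (R (suc a , b))
      ≡⟨ cong (λ is → count A (cartesianProduct is (upTo b))) (upTo-∷ʳ a) ⟨
    count A (cartesianProduct (upTo a ∷ʳ a) (upTo b))
      ≡⟨ cong (count A) (cartesianProductWith-distribʳ-++ _,_ (upTo a) (a ∷ []) (upTo b)) ⟩
    count A (R (a , b) ++ (map (a ,_) (upTo b) ++ []))
      ≡⟨ count-++ A (R (a , b)) _ ⟩
    count A (R (a , b)) + count A (map (a ,_) (upTo b) ++ [])
      ≡⟨ cong₂ (λ x l → x + count A l) (length-markers a b) (++-identityʳ (map (a ,_) (upTo b))) ⟩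
    tally a b + count A (map (a ,_) (upTo b))
      ≡⟨ cong (tally a b +_) (count-upTo A (a ,_) b) ⟩
    tally (suc a) b
      ∎
    where open ≡-Reasoning

  -- `tally` sums column by column; this splits off the top row instead.
  tally-row : ∀ a b → tally a (suc b) ≡ tally a b + row-tally a b
  tally-row a b = Σ-+ a _ _

-- For 1 ≤ s ≤ n the value n + 1 - s is again positive, so the second reflection stays out of the
-- clause for 0.
reflect-involutive : ∀ {n s} → s ≤ n → reflect n (reflect n s) ≡ s
reflect-involutive {n} {zero}  _   = refl
reflect-involutive {n} {suc s} s<n = begin
  reflect n (n ∸ s)  ≡⟨ reflect-positive (m<n⇒0<n∸m s<n) ⟩
  suc n ∸ (n ∸ s)    ≡⟨ +-∸-assoc 1 (m∸n≤m n s) ⟩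
  suc (n ∸ (n ∸ s))  ≡⟨ cong suc (m∸[m∸n]≡n (<⇒≤ s<n)) ⟩
  suc s              ∎
  where
  open ≡-Reasoning
  reflect-positive : ∀ {r} → 0 < r → reflect n r ≡ suc n ∸ r
  reflect-positive (s≤s _) = refl

-- The right/up border as a lattice path.

-- `upTo` is `applyUpTo id`; a general `f` is carried since the recursion composes it with `suc`.
count-initial≥ : ∀ (p : ℕ → Bool) (f : ℕ → ℕ) n {k} → k ≤ n → (∀ {i} → i < k → T (p (f i))) →
                 k ≤ count p (applyUpTo f n)
count-initial≥ p f n       {zero}  _         _  = z≤n
count-initial≥ p f (suc n) {suc k} (s≤s k≤n) pf with p (f 0) | pf {0} z<s
... | true | _ = s≤s (count-initial≥ p (f ∘ suc) n k≤n (pf ∘ s<s))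

here-or : ∀ {v w : Vertex} {xs} → (v ≢ w → v ∈ˡ xs) → v ∈ˡ w ∷ xs
here-or {v} {w} v∈xs with ≡-dec _≟_ _≟_ v w
... | yes refl = here refl
... | no  v≢w  = there (v∈xs v≢w)

∈-if : ∀ {A : Set} {v : A} {xs ys} c → (T c → v ∈ˡ xs) → (¬ T c → v ∈ˡ ys) →
       v ∈ˡ (if c then xs else ys)
∈-if true  v∈xs _    = v∈xs _
∈-if false _    v∈ys = v∈ys id

module _ (F : FerrersBoard) where
  open FerrersBoard F

  Board : Rel ℕ 0ℓ
  Board = Marks squares

  board-closed : ∀ {i i′ j j′} → i′ ≤ i → j′ ≤ j → Board i j → Board i′ j′
  board-closed {i} {i′} {j} {j′} i′≤i j′≤j s∈ =
    -- The witness is the upper right corner of the square, the last entry of `corners`.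
    All.lookup (closed (suc i , suc j) ((i , j) , s∈ , there (there (there (here refl)))))
               (∈-cartesianProduct⁺ (∈-upTo⁺ (s≤s i′≤i)) (∈-upTo⁺ (s≤s j′≤j)))

  isBoard : IsBoard Board
  isBoard = record
    { dec     = λ i j → T? (squares (i , j))
    ; size    = m
    ; bounded = bounded _ _
    ; closed  = board-closed
    }

  row<height : ∀ {i j} → Board i j → j < height
  row<height {i} {j} s∈ = ≤-trans
    (count-initial≥ (λ j → squares (i , j)) id m (proj₂ (bounded i j s∈))
      (λ y<sj → board-closed ≤-refl (≤-pred y<sj) s∈))
    (All.lookup (xs≤max 0 (map columnLength (upTo m)))
      (∈-map⁺ columnLength (∈-upTo⁺ (proj₁ (bounded i j s∈)))))

  module _ {x y} (s∈ : Board x y) (¬s∈ : ¬ Board (suc x) (suc y)) where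

    private
      V : Vertex
      V = suc x , suc y

      right : ∀ {a b} → a ≤ suc x → y ≤ b → V ≢ (a , suc b) → Board a b → a < suc x
      right a≤ y≤b away t with m≤n⇒m<n∨m≡n a≤ | m≤n⇒m<n∨m≡n y≤b
      ... | inj₁ a<   | _         = a<
      ... | inj₂ refl | inj₂ refl = contradiction refl away
      ... | inj₂ refl | inj₁ y<b  = contradiction (board-closed ≤-refl y<b t) ¬s∈

      down : ∀ {a b} → a ≤ suc x → y ≤ b → V ≢ (a , suc b) → ¬ Board a b → y < b
      down a≤ y≤b away f with m≤n⇒m<n∨m≡n a≤ | m≤n⇒m<n∨m≡n y≤b
      ... | _              | inj₁ y<b  = y<b
      ... | inj₂ refl      | inj₂ refl = contradiction refl away
      ... | inj₁ (s≤s a≤x) | inj₂ refl = contradiction (board-closed a≤x ≤-refl s∈) f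

    -- Until it meets `V`, the path stays weakly left of and above it. On the line x = `suc x` above
    -- `V` it cannot step right, as `(suc x , suc y)` is off the board; at height `suc y` left of
    -- `V` it cannot step down, as `(x , y)` is on the board.
    corner∈borderFrom : ∀ r a b → a + r ≡ m → a ≤ suc x → suc y ≤ b → V ∈ˡ borderFrom r a b
    corner∈borderFrom zero a (suc b) a≡m a≤ (s≤s y≤b) = here-or λ away →
      -- With no columns left, `a = m`, so the square to the right is outside the array and the
      -- forced step down is legitimate.
      corner∈borderFrom zero a b a≡m a≤
        (down a≤ y≤b away λ t →
          <⇒≢ (proj₁ (bounded a b t)) (trans (sym (+-identityʳ a)) a≡m))
    corner∈borderFrom (suc r) a (suc b) a≡m a≤ (s≤s y≤b) = here-or λ away →
      ∈-if (squares (a , b))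
        (λ t → corner∈borderFrom r (suc a) (suc b) (trans (sym (+-suc a r)) a≡m)
                 (right a≤ y≤b away t) (s≤s y≤b))
        (λ f → corner∈borderFrom (suc r) a b a≡m a≤ (down a≤ y≤b away f))

  corner∈border : ∀ {x y} → Board x y → ¬ Board (suc x) (suc y) → (suc x , suc y) ∈ˡ border
  corner∈border s∈ ¬s∈ = corner∈borderFrom s∈ ¬s∈ m 0 height refl z≤n (row<height s∈)

  -- Where the diagonal from `(i , j)` leaves the board, the upper right corner of its square is on
  -- the border; within `m` steps it has left the array.
  dominating-corner : ∀ {i j} → Board i j → ∃[ V ] V ∈ˡ border × (i , j) ↗ V
  dominating-corner {i} {j} s∈
    with lastTrue (λ d → T? (squares (i + d , j + d)))
           (subst₂ Board (sym (+-identityʳ i)) (sym (+-identityʳ j)) s∈)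
           m (λ s → ≤⇒≯ (m≤n+m m i) (proj₁ (bounded _ _ s)))
  ... | d , s , ¬s =
      (suc (i + d) , suc (j + d))
    , corner∈border s (subst₂ (λ x y → ¬ Board x y) (+-suc i d) (+-suc j d) ¬s)
    , (s≤s (m≤m+n i d) , s≤s (m≤m+n j d))

-- Placements on a board as relations.

module _ {F : FerrersBoard} where
  open FerrersBoard F

  isFull : (P : RookPlacement F) → RookPlacement.IsFull P → IsFull (Board F) (Marks (RookPlacement.markers P))
  isFull P (columns , rows) = record
    { onBoard    = onBoard _
    ; columnwise = columnwise _ _ _
    ; rowwise    = rowwise _ _ _
    ; inColumn   = λ s → columns _ (_ , s)
    ; inRow      = λ s → rows _ (_ , s)
    }
    where open RookPlacement P

  module _ (P : RookPlacement F) where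
    open RookPlacement P

    triple⊆ : ∀ {a b i₁ i₂ i₃ j₁ j₂ j₃} → i₁ < i₂ → i₂ < i₃ → i₃ < a → j₁ < b → j₂ < b → j₃ < b →
              (i₁ , j₁) ∈ markers → (i₂ , j₂) ∈ markers → (i₃ , j₃) ∈ markers →
              (j₁ ∷ j₂ ∷ j₃ ∷ []) ⊆ map proj₂ (markersIn (a , b))
    triple⊆ i₁<i₂ i₂<i₃ i₃<a j₁<b j₂<b j₃<b p₁ p₂ p₃ =
      ⊆-map⁺ proj₂ (⊆-markers markers
        (∷ʳ-⊆-upTo (∷ʳ-⊆-upTo (∷ʳ-⊆-upTo (minimum _) i₁<i₂) i₂<i₃) i₃<a)
        (j₁<b ∷ j₂<b ∷ j₃<b ∷ []) (p₁ ∷ p₂ ∷ p₃ ∷ []))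

    private
      both : ∀ {A B : Set} → A → B → A ⇔ B
      both a b = mk⇔ (λ _ → b) (λ _ → a)

      neither : ∀ {A B : Set} → ¬ A → ¬ B → A ⇔ B
      neither ¬a ¬b = mk⇔ (λ a → contradiction a ¬a) (λ b → contradiction b ¬b)

    -- A border vertex beyond the square `(i₃ , j₂)` has all three markers in its rectangle, where
    -- they would read as the pattern.
    avoids231 : Avoids P p231 → Avoids231 (Board F) (Marks markers)
    avoids231 avoids {j₁ = j₁} {j₂} {j₃} i₁<i₂ i₂<i₃ j₃<j₁ j₁<j₂ s p₁ p₂ p₃
      with dominating-corner F s
    ... | V , V∈ , i₃<a , j₂<b =
      avoids V V∈ ( j₁ ∷ j₂ ∷ j₃ ∷ []
                  , triple⊆ i₁<i₂ i₂<i₃ i₃<a (<-trans j₁<j₂ j₂<b) j₂<b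
                            (<-trans j₃<j₁ (<-trans j₁<j₂ j₂<b)) p₁ p₂ p₃
                  , iso)
      where
      iso : OrderIsomorphic (j₁ ∷ j₂ ∷ j₃ ∷ []) p231
      iso zero             zero             = neither (<-irrefl refl) (<-irrefl refl)
      iso zero             (suc zero)       = both j₁<j₂ (from-yes (2 <? 3))
      iso zero             (suc (suc zero)) = neither (<-asym j₃<j₁) (from-no (2 <? 1))
      iso (suc zero)       zero             = neither (<-asym j₁<j₂) (from-no (3 <? 2))
      iso (suc zero)       (suc zero)       = neither (<-irrefl refl) (<-irrefl refl)
      iso (suc zero)       (suc (suc zero)) = neither (<-asym (<-trans j₃<j₁ j₁<j₂)) (from-no (3 <? 1))
      iso (suc (suc zero)) zero             = both j₃<j₁ (from-yes (1 <? 2))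
      iso (suc (suc zero)) (suc zero)       = both (<-trans j₃<j₁ j₁<j₂) (from-yes (1 <? 3))
      iso (suc (suc zero)) (suc (suc zero)) = neither (<-irrefl refl) (<-irrefl refl)

    avoids312 : Avoids P p312 → Avoids312 (Board F) (Marks markers)
    avoids312 avoids {j₁ = j₁} {j₂} {j₃} i₁<i₂ i₂<i₃ j₂<j₃ j₃<j₁ s p₁ p₂ p₃
      with dominating-corner F s
    ... | V , V∈ , i₃<a , j₁<b =
      avoids V V∈ ( j₁ ∷ j₂ ∷ j₃ ∷ []
                  , triple⊆ i₁<i₂ i₂<i₃ i₃<a j₁<b (<-trans j₂<j₃ (<-trans j₃<j₁ j₁<b))
                            (<-trans j₃<j₁ j₁<b) p₁ p₂ p₃
                  , iso)
      where
      iso : OrderIsomorphic (j₁ ∷ j₂ ∷ j₃ ∷ []) p312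
      iso zero             zero             = neither (<-irrefl refl) (<-irrefl refl)
      iso zero             (suc zero)       = neither (<-asym (<-trans j₂<j₃ j₃<j₁)) (from-no (3 <? 1))
      iso zero             (suc (suc zero)) = neither (<-asym j₃<j₁) (from-no (3 <? 2))
      iso (suc zero)       zero             = both (<-trans j₂<j₃ j₃<j₁) (from-yes (1 <? 3))
      iso (suc zero)       (suc zero)       = neither (<-irrefl refl) (<-irrefl refl)
      iso (suc zero)       (suc (suc zero)) = both j₂<j₃ (from-yes (1 <? 2))
      iso (suc (suc zero)) zero             = both j₃<j₁ (from-yes (2 <? 3))
      iso (suc (suc zero)) (suc zero)       = neither (<-asym j₂<j₃) (from-no (2 <? 1))
      iso (suc (suc zero)) (suc (suc zero)) = neither (<-irrefl refl) (<-irrefl refl)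

-- Independence of N from the full placement.

module _ {F : FerrersBoard} (P Q : RookPlacement F)
         (fullP : RookPlacement.IsFull P) (fullQ : RookPlacement.IsFull Q) where
  open FerrersBoard F
  private
    module P = RookPlacement P
    module Q = RookPlacement Q

  -- From `m` rows on, each of the `suc x` columns contributes its one marker.
  tally-all-rows : ∀ {x y} → Board F x y → ∀ {n} → m ≤ n → tally P.markers (suc x) n ≡ tally Q.markers (suc x) n
  tally-all-rows {x} s∈ {n} m≤n = Σ-cong (suc x) λ i<sx →
    let s′ = board-closed F (≤-pred i<sx) z≤n s∈ in
    trans (column-sum P fullP s′) (sym (column-sum Q fullQ s′))
    where
    column-sum : ∀ (P : RookPlacement F) → RookPlacement.IsFull P → ∀ {i} → Board F i 0 →
                 (Σ< n) (λ j → indicator (RookPlacement.markers P (i , j))) ≡ 1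
    column-sum P full {i} s with IsFull.inColumn (isFull P full) s
    ... | j , p = Σ-unique n _
      (<-≤-trans (proj₂ (bounded i j (RookPlacement.onBoard P _ p))) m≤n) p
      (λ p′ → RookPlacement.columnwise P _ _ _ p′ p)

  -- As `(a , j)` is off the board, every marker of row `j` lies left of column `a`: one if the row
  -- has a square, none otherwise.
  row-tally≡ : ∀ {a j} → ¬ Board F a j → row-tally P.markers a j ≡ row-tally Q.markers a j
  row-tally≡ {a} {j} ¬s∈ with T? (squares (0 , j))
  ... | yes s = trans (row-sum P fullP) (sym (row-sum Q fullQ))
    where
    row-sum : ∀ (P : RookPlacement F) → RookPlacement.IsFull P → row-tally (RookPlacement.markers P) a j ≡ 1
    row-sum P full with IsFull.inRow (isFull P full) s
    ... | i , p = Σ-unique a _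
      (≰⇒> λ a≤i → ¬s∈ (board-closed F a≤i ≤-refl (RookPlacement.onBoard P _ p))) p
      (λ p′ → RookPlacement.rowwise P _ _ _ p′ p)
  ... | no ¬s = trans (row-sum P) (sym (row-sum Q))
    where
    row-sum : ∀ (P : RookPlacement F) → row-tally (RookPlacement.markers P) a j ≡ 0
    row-sum P = Σ-none a _ (λ _ p → ¬s (board-closed F z≤n ≤-refl (RookPlacement.onBoard P _ p)))

  -- The columns up to x hold one marker each, and the rows from b on have all their markers there.
  tally≡ : ∀ {x y b} → Board F x y → ¬ Board F (suc x) b → ∀ d → m ≤ b + d →
           tally P.markers (suc x) b ≡ tally Q.markers (suc x) b
  tally≡ {b = b} s∈ ¬s∈ zero    m≤ = tally-all-rows s∈ (subst (m ≤_) (+-identityʳ b) m≤)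
  tally≡ {x} {b = b} s∈ ¬s∈ (suc d) m≤ = +-cancelʳ-≡ (row-tally P.markers (suc x) b) _ _ (begin
    tally P.markers (suc x) b + row-tally P.markers (suc x) b  ≡⟨ tally-row P.markers (suc x) b ⟨
    tally P.markers (suc x) (suc b)
      ≡⟨ tally≡ s∈ (¬s∈ ∘ board-closed F ≤-refl (n≤1+n b)) d (subst (m ≤_) (+-suc b d) m≤) ⟩
    tally Q.markers (suc x) (suc b)                            ≡⟨ tally-row Q.markers (suc x) b ⟩
    tally Q.markers (suc x) b + row-tally Q.markers (suc x) b
      ≡⟨ cong (tally Q.markers (suc x) b +_) (row-tally≡ ¬s∈) ⟨
    tally Q.markers (suc x) b + row-tally P.markers (suc x) b  ∎)
    where open ≡-Reasoning

  N≡ : ∀ {x y} → Board F x y → ¬ Board F (suc x) (suc y) →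
       N P (suc x , suc y) ≡ N Q (suc x , suc y)
  N≡ {x} {y} s∈ ¬s∈ = begin
    N P (suc x , suc y)              ≡⟨ length-markers P.markers (suc x) (suc y) ⟩
    tally P.markers (suc x) (suc y)  ≡⟨ tally≡ s∈ ¬s∈ m (m≤n+m m (suc y)) ⟩
    tally Q.markers (suc x) (suc y)  ≡⟨ length-markers Q.markers (suc x) (suc y) ⟨
    N Q (suc x , suc y)              ∎
    where open ≡-Reasoning

-- Placements determined by S, and the two maps as inverses.

T-extensional : ∀ {x y} → (T x → T y) × (T y → T x) → x ≡ y
T-extensional {true}  {true}  _         = refl
T-extensional {true}  {false} (x⇒y , _) = contradiction _ x⇒y
T-extensional {false} {true}  (_ , y⇒x) = contradiction _ y⇒x
T-extensional {false} {false} _         = refl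

map-zipWith-injective : ∀ {A : Set} {f g h : A → ℕ} (k : ℕ → ℕ → ℕ) xs →
  map f xs ≡ zipWith k (map g xs) (map h xs) → ∀ {x} → x ∈ˡ xs → f x ≡ k (g x) (h x)
map-zipWith-injective k (x ∷ xs) eq (here refl) = ∷-injectiveˡ eq
map-zipWith-injective k (x ∷ xs) eq (there x∈)  = map-zipWith-injective k xs (∷-injectiveʳ eq) x∈

module _ {F : FerrersBoard} where
  open FerrersBoard F
  open FullAvoiding

  Determined : ∀ {k} → Pattern k → Set
  Determined τ = ∀ (P Q : FullAvoiding F τ) →
    (∀ {x y} → Board F x y → ¬ Board F (suc x) (suc y) →
       S (placement P) (suc x , suc y) ≡ S (placement Q) (suc x , suc y)) → P ≈ Q

  determined231 : Determined p231
  determined231 P Q S≡ (i , j) = T-extensional (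
    unique231 (isBoard F) (isFull (placement P) (full P)) (isFull (placement Q) (full Q))
      (avoids231 (placement P) (avoids P)) (avoids231 (placement Q) (avoids Q))
      (λ s ¬s → same-longest⇒same-chains (markers P) (markers Q) (S≡ s ¬s)) i j)

  determined312 : Determined p312
  determined312 P Q S≡ (i , j) = T-extensional (
    unique312 (isBoard F) (isFull (placement P) (full P)) (isFull (placement Q) (full Q))
      (avoids312 (placement P) (avoids P)) (avoids312 (placement Q) (avoids Q))
      (λ s ¬s → same-longest⇒same-chains (markers P) (markers Q) (S≡ s ¬s)) i j)

  markersIn-cong : ∀ {k} {τ : Pattern k} {P Q : FullAvoiding F τ} → P ≈ Q →
                   ∀ V → markersIn P V ≡ markersIn Q V
  markersIn-cong P≈Q V =
    filter-≐ _ _ ((λ {s} → subst T (P≈Q s)) , (λ {s} → subst T (sym (P≈Q s)))) (R V)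

  module _ {k l} {σ : Pattern k} {τ : Pattern l} {f : FullAvoiding F σ → FullAvoiding F τ}
           (reflects : Reflects f) where

    reflected : ∀ P {V} → V ∈ˡ border →
                S (placement (f P)) V ≡ reflect (N (placement P) V) (S (placement P) V)
    reflected P = map-zipWith-injective reflect border (reflects P)

    -- `_≈_` compares markers only, so congruence has to be derived: the markers of `P` fix S and N
    -- of `P`, hence S of `f P` on the border, hence the markers of `f P`.
    reflects-cong : Determined τ → ∀ {P Q} → P ≈ Q → f P ≈ f Q
    reflects-cong determined {P} {Q} P≈Q = determined (f P) (f Q) λ {x} {y} s ¬s →
      let V∈ = corner∈border F s ¬s in
      trans (reflected P V∈)
        (trans (cong (λ ms → reflect (length ms) (longestIncreasing ms))
                     (markersIn-cong {P = P} {Q} P≈Q (suc x , suc y)))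
               (sym (reflected Q V∈)))

    -- N is the same for `f P` and `P`, so the two reflections cancel and `g (f P)` has the S-values
    -- of `P`.
    retract : ∀ {g} → Reflects g → Determined σ → ∀ P → g (f P) ≈ P
    retract {g} reflects′ determined P = determined (g (f P)) P λ {x} {y} s ¬s →
      let V  = suc x , suc y
          V∈ = corner∈border F s ¬s
          p  = placement P
          q  = placement (f P)
      in begin
        S (placement (g (f P))) V                  ≡⟨ map-zipWith-injective reflect border (reflects′ (f P)) V∈ ⟩
        reflect (N q V) (S q V)                    ≡⟨ cong₂ reflect (N≡ q p (full (f P)) (full P) s ¬s) (reflected P V∈) ⟩
        reflect (N p V) (reflect (N p V) (S p V))  ≡⟨ reflect-involutive (longest≤length (markers P) {suc x} {suc y}) ⟩
        S p V                                      ∎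
      where open ≡-Reasoning

theorem3 : (F : FerrersBoard)
    (α : FullAvoiding F p231 → FullAvoiding F p312)
    (β : FullAvoiding F p312 → FullAvoiding F p231) →
    Reflects α → Reflects β →
    Inverseᵇ _≈_ _≈_ α β × Bijective _≈_ _≈_ α × Bijective _≈_ _≈_ β
theorem3 F α β reflects-α reflects-β =
  inverse , bijective {f = α} {β} inverse , bijective {f = β} {α} (swap inverse)
  where
  bijective : ∀ {k l} {σ : Pattern k} {τ : Pattern l}
              {f : FullAvoiding F σ → FullAvoiding F τ} {g : FullAvoiding F τ → FullAvoiding F σ} →
              Inverseᵇ _≈_ _≈_ f g → Bijective _≈_ _≈_ f
  bijective {f = f} {g} = inverseᵇ⇒bijective {f = f} {g} _≈_
    (λ _ → refl) (λ P≈Q s → sym (P≈Q s)) (λ P≈Q Q≈R s → trans (P≈Q s) (Q≈R s))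

  inverse : Inverseᵇ _≈_ _≈_ α β
  inverse =
      -- `Inverseᵇ` gives the argument only up to `_≈_`: `reflects-cong` replaces it by `β Q`, and
      -- `retract` then cancels.
      (λ {Q} {P} P≈βQ s → trans
        (reflects-cong {f = α} reflects-α determined312 {P} {β Q} P≈βQ s)
        (retract {f = β} reflects-β {α} reflects-α determined312 Q s))
    , (λ {P} {Q} Q≈αP s → trans
        (reflects-cong {f = β} reflects-β determined231 {Q} {α P} Q≈αP s)
        (retract {f = α} reflects-α {β} reflects-β determined231 P s))
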